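{- Let $m\ge3$ and let $T_m$ be the set of permutations $\tau\in\mathcal{S}_m$ with $\tau_{m-1}=m$ and $\tau_m=m-1$. A permutation $\pi\in\mathcal{S}_n$ avoids every pattern in $T_m$ if and only if every element $(i,j)$ of its essential set $\mathcal{E}(\pi)$ has rank $\rho(i,j)\le m-3$.
   Context: A permutation $\pi\in\mathcal{S}_n$ avoids $\tau\in\mathcal{S}_k$ if there are no indices $i_1<\dots<i_k$ with $\pi_{i_1}\cdots\pi_{i_k}$ in the same relative order as $\tau_1\cdots\tau_k$. Represent $\pi$ by an $n\times n$ array, rows $i$ numbered top to bottom, columns $j$ left to right, with a dot in square $(i,\pi_i)$. The diagram $D(\pi)$ is the set of squares $(i,j)$ with $\pi_i>j$ and $\pi^{ -1}(j)>i$. The essential set $\mathcal{E}(\pi)$ is the set of $(i,j)\in D(\pi)$ with $(i+1,j)\notin D(\pi)$ and $(i,j+1)\notin D(\pi)$ (squares outside the array count as not in $D(\pi)$). The rank of a square $(i,j)$ is $\rho(i,j)=\#\{k<i:\pi_k<j\}$. -}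

module Defs where

open import Data.Nat.Base as ℕ using (ℕ; suc; _∸_)
open import Data.Fin.Base using (Fin; toℕ; _<_; _>_)
open import Data.Fin.Properties using (_<?_)
open import Data.Fin.Permutation using (Permutation′; _⟨$⟩ʳ_; _⟨$⟩ˡ_)
open import Data.List.Base using (length; filter; allFin)
open import Data.Product.Base using (Σ-syntax; _×_; _,_)
open import Function.Bundles using (_⇔_)
open import Level using (0ℓ)
open import Relation.Binary.PropositionalEquality using (_≡_)
open import Relation.Nullary using (¬_)
open import Relation.Nullary.Decidable using (_×-dec_)
open import Relation.Unary using (Pred; _∈_; _∉_)

-- A permutation of {1,…,n} is represented on Fin n, so the element a of Fin n
-- stands for the position, value, row or column label a.
label : ∀ {n} → Fin n → ℕ
label a = suc (toℕ a)

Contains : ∀ {n k} → Permutation′ n → Permutation′ k → Set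
Contains {n} {k} π τ =
  Σ[ ι ∈ (Fin k → Fin n) ]
    (∀ a b → a < b → ι a < ι b)
    × (∀ a b → (π ⟨$⟩ʳ ι a < π ⟨$⟩ʳ ι b) ⇔ (τ ⟨$⟩ʳ a < τ ⟨$⟩ʳ b))

Avoids : ∀ {n k} → Permutation′ n → Permutation′ k → Set
Avoids π τ = ¬ Contains π τ

-- Neither component is vacuous once m ≥ 2: positions m ∸ 1 and m then exist
-- and are unique.
T : ∀ m → Pred (Permutation′ m) 0ℓ
T m τ = (∀ a → label a ≡ m ∸ 1 → label (τ ⟨$⟩ʳ a) ≡ m)
      × (∀ a → label a ≡ m → label (τ ⟨$⟩ʳ a) ≡ m ∸ 1)

Square : ℕ → Set
Square n = Fin n × Fin n

Diagram : ∀ {n} → Permutation′ n → Pred (Square n) 0ℓ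
Diagram π (i , j) = (π ⟨$⟩ʳ i > j) × (π ⟨$⟩ˡ j > i)

-- When i is the last row (or j the last column) no i′ (or j′) qualifies, which
-- matches the convention that squares outside the array are not in the diagram.
EssentialSet : ∀ {n} → Permutation′ n → Pred (Square n) 0ℓ
EssentialSet π (i , j) =
  (i , j) ∈ Diagram π
  × (∀ i′ → label i′ ≡ suc (label i) → (i′ , j) ∉ Diagram π)
  × (∀ j′ → label j′ ≡ suc (label j) → (i , j′) ∉ Diagram π)

rank : ∀ {n} → Permutation′ n → Square n → ℕ
rank {n} π (i , j) =
  length (filter (λ k → (k <? i) ×-dec ((π ⟨$⟩ʳ k) <? j)) (allFin n))

-- A square (i , j) of the diagram of rank at least m ∸ 2 amounts to an
-- occurrence of a pattern of T m: the dots counted by the rank, the dot of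
-- row i and the dot of column j, in this order. Moving down or to the right
-- inside the diagram does not decrease the rank, and such a walk can only stop
-- at an essential square.
module Submission where

open import Data.Fin.Base
  using (Fin; zero; suc; toℕ; fromℕ; inject₁; inject≤; fromℕ<; _<_; _>_)
  renaming (_≤_ to _≤ᶠ_)
open import Data.Fin.Induction using (>-wellFounded)
open import Data.Fin.Permutation
  using (Permutation′; permutation; _⟨$⟩ʳ_; _⟨$⟩ˡ_; inverseˡ; inverseʳ)
open import Data.Fin.Properties
  using (_<?_; _≟_; any?; toℕ<n; toℕ-injective; toℕ-fromℕ; toℕ-fromℕ<;
         toℕ-inject₁; toℕ-inject≤; ≤fromℕ; <-cmp; <-irrefl; <-asym; <-trans; injective⇒≤; <⇒notInjective)
open import Data.Fin.Relation.Unary.Top using (view; ‵fromℕ; ‵inj₁; view-fromℕ; view-inject₁)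
open import Data.List.Base using (List; _∷_; length; filter; allFin; lookup)
open import Data.List.Membership.Propositional using (lose) renaming (_∈_ to _∈ˡ_)
open import Data.List.Membership.Propositional.Properties
  using (∈-allFin; ∈-filter⁺; ∈-filter⁻; ∈-lookup)
open import Data.List.Properties using (filter-notAll; length-tabulate)
open import Data.List.Relation.Binary.Equality.Propositional using (≋⇒≡)
open import Data.List.Relation.Binary.Sublist.Propositional using (⊆-refl) renaming (_⊆_ to _⊆ˡ_)
open import Data.List.Relation.Binary.Sublist.Propositional.Properties
  using (filter⁺; length-mono-≤; to-≋)
import Data.List.Relation.Unary.All as All
open import Data.List.Relation.Unary.AllPairs using (AllPairs; _∷_)
import Data.List.Relation.Unary.AllPairs.Properties as AllPairs
open import Data.List.Relation.Unary.Any using (index)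
open import Data.List.Relation.Unary.Any.Properties using (lookup-index)
open import Data.Nat.Base as ℕ using (ℕ; suc; _≤_; _≥_; _∸_; s≤s)
import Data.Nat.Properties as ℕ
open import Data.Product.Base using (Σ-syntax; _×_; _,_; proj₁; proj₂; ∃-syntax)
open import Function.Base using (_∘_)
open import Function.Bundles using (_⇔_; mk⇔; Equivalence)
open import Function.Definitions using (Injective)
open import Induction.WellFounded using (Acc; acc)
open import Level using (Level)
open import Relation.Binary.Core using (Rel)
open import Relation.Binary.Definitions using (tri<; tri≈; tri>)
open import Relation.Binary.PropositionalEquality
  using (_≡_; _≢_; refl; sym; trans; cong; subst; subst₂; module ≡-Reasoning)
open import Relation.Nullary using (yes; no; contradiction)
open import Relation.Nullary.Decidable using (_×-dec_)
open import Relation.Unary using (Pred; Decidable; _∈_; _∉_; _⊆_)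
open import Defs

private
  variable
    a p q r : Level
    A : Set a
    k m n : ℕ

-- Counting and listing the elements of a decidable subset of `Fin n`.

-- Filtering by the smaller predicate leaves a sublist. If the lengths agreed, the two filtered
-- lists would coincide, and `x` would satisfy `P`.
length-filter-< : {P : Pred A p} {Q : Pred A q} (P? : Decidable P) (Q? : Decidable Q) →
  P ⊆ Q → ∀ {x} {xs : List A} → x ∈ˡ xs → x ∈ Q → x ∉ P →
  length (filter P? xs) ℕ.< length (filter Q? xs)
length-filter-< P? Q? P⊆Q {x} {xs} x∈xs Qx ¬Px = ℕ.≤∧≢⇒< (length-mono-≤ sub) λ eq →
  ¬Px (proj₂ (∈-filter⁻ P? {xs = xs}
    (subst (x ∈ˡ_) (sym (≋⇒≡ (to-≋ eq sub))) (∈-filter⁺ Q? x∈xs Qx))))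
  where
  sub : filter P? xs ⊆ˡ filter Q? xs
  sub = filter⁺ P? Q? (λ { refl → P⊆Q }) (⊆-refl {x = xs})

lookup-AllPairs : {R : Rel A r} {xs : List A} → AllPairs R xs →
  ∀ i j → i < j → R (lookup xs i) (lookup xs j)
lookup-AllPairs {xs = _ ∷ xs} (x∼ ∷ _)  zero    (suc j) _   = All.lookup x∼ (∈-lookup {xs = xs} j)
lookup-AllPairs                    (_ ∷ xs∼) (suc i) (suc j) i<j = lookup-AllPairs xs∼ i j (ℕ.s<s⁻¹ i<j)

module _ {P : Pred (Fin n) p} (P? : Decidable P) where

  -- Each `g b` occurs in the filtered list, and the index of an occurrence determines `g b` by
  -- lookup, so `Fin k` injects into the indices of that list.
  injective⇒≤length-filter : {g : Fin k → Fin n} → Injective _≡_ _≡_ g → (∀ b → g b ∈ P) →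
    k ≤ length (filter P? (allFin n))
  injective⇒≤length-filter {g = g} g-inj g∈P = injective⇒≤ {f = index ∘ g∈} λ {b} {c} eq → g-inj (begin
    g b                                             ≡⟨ lookup-index (g∈ b) ⟩
    lookup (filter P? (allFin n)) (index (g∈ b))    ≡⟨ cong (lookup (filter P? (allFin n))) eq ⟩
    lookup (filter P? (allFin n)) (index (g∈ c))    ≡⟨ lookup-index (g∈ c) ⟨
    g c                                             ∎)
    where
    open ≡-Reasoning
    g∈ : ∀ b → g b ∈ˡ filter P? (allFin n)
    g∈ b = ∈-filter⁺ P? (∈-allFin (g b)) (g∈P b)

  -- `allFin n` is strictly increasing and filtering preserves this, so the first `k` entries of the
  -- filtered list serve as the values of `g`.
  ≤length-filter⇒increasing : k ≤ length (filter P? (allFin n)) →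
    Σ[ g ∈ (Fin k → Fin n) ] (∀ b c → b < c → g b < g c) × (∀ b → g b ∈ P)
  ≤length-filter⇒increasing k≤ =
    (λ b → lookup xs (inject≤ b k≤)) ,
    (λ b c b<c → lookup-AllPairs xs< _ _
      (subst₂ ℕ._<_ (sym (toℕ-inject≤ b k≤)) (sym (toℕ-inject≤ c k≤)) b<c)) ,
    (λ b → proj₂ (∈-filter⁻ P? {xs = allFin n} (∈-lookup {xs = xs} (inject≤ b k≤))))
    where
    xs = filter P? (allFin n)
    xs< : AllPairs _<_ xs
    xs< = AllPairs.filter⁺ P? (AllPairs.tabulate⁺-< (λ i<j → i<j))

-- Injective maps, permutations and standardization.

increasing⇒injective : {g : Fin k → Fin n} → (∀ b c → b < c → g b < g c) → Injective _≡_ _≡_ g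
increasing⇒injective g< {b} {c} eq with <-cmp b c
... | tri< b<c _ _ = contradiction (g< b c b<c) (<-irrefl eq)
... | tri≈ _ b≡c _ = b≡c
... | tri> _ _ c<b = contradiction (g< c b c<b) (<-irrefl (sym eq))

-- Pigeonhole: a missed value `x` could be put in front of the values of `f`, giving an injection of
-- `Fin (suc n)` into `Fin n`.
injective⇒surjective : {f : Fin n → Fin n} → Injective _≡_ _≡_ f → ∀ x → ∃[ b ] f b ≡ x
injective⇒surjective {n} {f} f-inj x with any? (λ b → f b ≟ x)
... | yes hit  = hit
... | no  miss = contradiction (λ {b} {c} → x∷f-injective {b} {c}) (<⇒notInjective (ℕ.n<1+n n))
  where
  x∷f : Fin (suc n) → Fin n
  x∷f zero    = x
  x∷f (suc b) = f b
  x∷f-injective : Injective _≡_ _≡_ x∷f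
  x∷f-injective {zero}  {zero}  _  = refl
  x∷f-injective {zero}  {suc c} eq = contradiction (c , sym eq) miss
  x∷f-injective {suc b} {zero}  eq = contradiction (b , eq) miss
  x∷f-injective {suc b} {suc c} eq = cong suc (f-inj eq)

injective⇒permutation : {f : Fin n → Fin n} → Injective _≡_ _≡_ f → Permutation′ n
injective⇒permutation {f = f} f-inj =
  permutation f (proj₁ ∘ surj) (proj₂ ∘ surj) (λ b → f-inj (proj₂ (surj (f b))))
  where surj = injective⇒surjective f-inj

⟨$⟩ʳ-injective : (π : Permutation′ n) → Injective _≡_ _≡_ (π ⟨$⟩ʳ_)
⟨$⟩ʳ-injective π eq = trans (sym (inverseˡ π)) (trans (cong (π ⟨$⟩ˡ_) eq) (inverseˡ π))

-- The standardization sends b to the number of c with f c < f b.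
standardize : (f : Fin k → Fin n) → Injective _≡_ _≡_ f →
  Σ[ τ ∈ Permutation′ k ] (∀ b c → f b < f c ⇔ τ ⟨$⟩ʳ b < τ ⟨$⟩ʳ c)
standardize {k} f f-inj = τ , λ b c → mk⇔ (τ-mono b c) (τ-reflects b c)
  where
  below : Fin k → ℕ
  below b = length (filter (λ c → f c <? f b) (allFin k))

  below-< : ∀ b c → f b < f c → below b ℕ.< below c
  below-< b c fb<fc = length-filter-< (λ d → f d <? f b) (λ d → f d <? f c)
    (λ fd<fb → <-trans fd<fb fb<fc) (∈-allFin b) fb<fc (<-irrefl refl)

  below-injective : Injective _≡_ _≡_ below
  below-injective {b} {c} eq with <-cmp (f b) (f c)
  ... | tri< fb<fc _ _ = contradiction (below-< b c fb<fc) (ℕ.<-irrefl eq)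
  ... | tri≈ _ fb≡fc _ = f-inj fb≡fc
  ... | tri> _ _ fc<fb = contradiction (below-< c b fc<fb) (ℕ.<-irrefl (sym eq))

  below<k : ∀ b → below b ℕ.< k
  -- `b` fails its own test `f b < f b`, so the filter drops at least one of the `k` entries.
  below<k b = subst (below b ℕ.<_) (length-tabulate {n = k} (λ c → c))
    (filter-notAll _ (allFin k) (lose (∈-allFin b) (<-irrefl refl)))

  std : Fin k → Fin k
  std b = fromℕ< (below<k b)

  std-injective : Injective _≡_ _≡_ std
  std-injective eq = below-injective
    (trans (sym (toℕ-fromℕ< (below<k _))) (trans (cong toℕ eq) (toℕ-fromℕ< (below<k _))))

  τ = injective⇒permutation std-injective

  τ-mono : ∀ b c → f b < f c → τ ⟨$⟩ʳ b < τ ⟨$⟩ʳ c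
  τ-mono b c fb<fc =
    subst₂ ℕ._<_ (sym (toℕ-fromℕ< (below<k b))) (sym (toℕ-fromℕ< (below<k c))) (below-< b c fb<fc)

  τ-reflects : ∀ b c → τ ⟨$⟩ʳ b < τ ⟨$⟩ʳ c → f b < f c
  τ-reflects b c τb<τc with <-cmp (f b) (f c)
  ... | tri< fb<fc _ _ = fb<fc
  ... | tri≈ _ fb≡fc _ = contradiction τb<τc (<-irrefl (cong (τ ⟨$⟩ʳ_) (f-inj fb≡fc)))
  ... | tri> _ _ fc<fb = contradiction τb<τc (<-asym (τ-mono c b fc<fb))

-- Appending an entry, and the last two positions of a pattern.

-- The new entry sits at the greatest index, whereas pattern matching on `Fin` exposes the least
-- one; hence the view from the top.
snoc : (Fin k → A) → A → Fin (suc k) → A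
snoc g x b with view b
... | ‵fromℕ         = x
... | ‵inj₁ {i = c} _ = g c

snoc-fromℕ : ∀ (g : Fin k → A) x → snoc g x (fromℕ k) ≡ x
snoc-fromℕ {k = k} g x rewrite view-fromℕ k = refl

snoc-inject₁ : ∀ (g : Fin k → A) x b → snoc g x (inject₁ b) ≡ g b
snoc-inject₁ g x b rewrite view-inject₁ b = refl

snoc-All : {P : Pred A p} {g : Fin k → A} {x : A} →
  (∀ b → P (g b)) → P x → ∀ b → P (snoc g x b)
snoc-All Pg Px b with view b
... | ‵fromℕ         = Px
... | ‵inj₁ {i = c} _ = Pg c

snoc-increasing : {g : Fin k → Fin n} {x : Fin n} → (∀ b c → b < c → g b < g c) →
  (∀ b → g b < x) → ∀ b c → b < c → snoc g x b < snoc g x c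
snoc-increasing g< g<x b c b<c with view b | view c
... | ‵fromℕ          | _                = contradiction b<c (ℕ.≤⇒≯ (≤fromℕ c))
... | ‵inj₁ {i = b′} _ | ‵fromℕ          = g<x b′
... | ‵inj₁ {i = b′} _ | ‵inj₁ {i = c′} _ =
  g< b′ c′ (subst₂ ℕ._<_ (toℕ-inject₁ b′) (toℕ-inject₁ c′) b<c)

last : Fin (2 ℕ.+ k)
last {k} = fromℕ (suc k)

penultimate : Fin (2 ℕ.+ k)
penultimate {k} = inject₁ (fromℕ k)

earlier : Fin k → Fin (2 ℕ.+ k)
earlier b = inject₁ (inject₁ b)

toℕ-penultimate : toℕ (penultimate {k}) ≡ k
toℕ-penultimate {k} = trans (toℕ-inject₁ (fromℕ k)) (toℕ-fromℕ k)

toℕ-earlier : (b : Fin k) → toℕ (earlier b) ≡ toℕ b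
toℕ-earlier b = trans (toℕ-inject₁ (inject₁ b)) (toℕ-inject₁ b)

penultimate<last : penultimate {k} < last
penultimate<last {k} = subst₂ ℕ._<_ (sym toℕ-penultimate) (sym (toℕ-fromℕ (suc k))) (ℕ.n<1+n k)

earlier<penultimate : (b : Fin k) → earlier b < penultimate
earlier<penultimate b = subst₂ ℕ._<_ (sym (toℕ-earlier b)) (sym toℕ-penultimate) (toℕ<n b)

earlier-increasing : (b c : Fin k) → b < c → earlier b < earlier c
earlier-increasing b c = subst₂ ℕ._<_ (sym (toℕ-earlier b)) (sym (toℕ-earlier c))

-- The patterns of `T` described by relative order.

module _ (τ : Permutation′ (2 ℕ.+ k)) where

  -- T in terms of the relative order of the values only, which is what an
  -- occurrence of τ transports.
  EndsInTopDescent : Set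
  EndsInTopDescent = (∀ b → τ ⟨$⟩ʳ earlier b < τ ⟨$⟩ʳ last) × (τ ⟨$⟩ʳ last < τ ⟨$⟩ʳ penultimate)

  T⇒EndsInTopDescent : τ ∈ T (2 ℕ.+ k) → EndsInTopDescent
  T⇒EndsInTopDescent (Tp , Tl) = earlier<τlast , subst₂ ℕ._<_ (sym τl≡) (sym τp≡) (ℕ.n<1+n k)
    where
    τp≡ : toℕ (τ ⟨$⟩ʳ penultimate) ≡ suc k
    τp≡ = ℕ.suc-injective (Tp penultimate (cong suc toℕ-penultimate))
    τl≡ : toℕ (τ ⟨$⟩ʳ last) ≡ k
    τl≡ = ℕ.suc-injective (Tl last (cong suc (toℕ-fromℕ (suc k))))
    τ≢ : ∀ {b c} → b < c → toℕ (τ ⟨$⟩ʳ b) ≢ toℕ (τ ⟨$⟩ʳ c)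
    τ≢ b<c eq = <-irrefl (⟨$⟩ʳ-injective τ (toℕ-injective eq)) b<c
    earlier<τlast : ∀ b → τ ⟨$⟩ʳ earlier b < τ ⟨$⟩ʳ last
    earlier<τlast b = subst (toℕ (τ ⟨$⟩ʳ earlier b) ℕ.<_) (sym τl≡)
      -- The value is at most `suc k`. Injectivity of `τ` excludes first `suc k`, taken at
      -- `penultimate`, and then `k`, taken at `last`.
      (ℕ.≤∧≢⇒< (ℕ.s≤s⁻¹ (ℕ.≤∧≢⇒< (ℕ.s≤s⁻¹ (toℕ<n (τ ⟨$⟩ʳ earlier b)))
        λ eq → τ≢ (earlier<penultimate b) (trans eq (sym τp≡))))
        λ eq → τ≢ (<-trans (earlier<penultimate b) penultimate<last) (trans eq (sym τl≡)))

  -- The order relations make the value at `penultimate` the maximum and the value at `last` the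
  -- maximum of the others. As `τ` is onto, these maxima are `suc k` and `k`, counted from zero.
  EndsInTopDescent⇒T : EndsInTopDescent → τ ∈ T (2 ℕ.+ k)
  EndsInTopDescent⇒T (e<l , l<p) =
    (λ b eq → cong suc (trans (cong (toℕ ∘ (τ ⟨$⟩ʳ_))
      (toℕ-injective (trans (ℕ.suc-injective eq) (sym toℕ-penultimate)))) τp≡)) ,
    (λ b eq → cong suc (trans (cong (toℕ ∘ (τ ⟨$⟩ʳ_))
      (toℕ-injective (trans (ℕ.suc-injective eq) (sym (toℕ-fromℕ (suc k)))))) τl≡))
    where
    τ≤τp : ∀ b → τ ⟨$⟩ʳ b ≤ᶠ τ ⟨$⟩ʳ penultimate
    τ≤τp b with view b
    ... | ‵fromℕ                = ℕ.<⇒≤ l<p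
    ... | ‵inj₁ ‵fromℕ          = ℕ.≤-refl
    ... | ‵inj₁ (‵inj₁ {i = c} _) = ℕ.<⇒≤ (<-trans (e<l c) l<p)

    τp≡ : toℕ (τ ⟨$⟩ʳ penultimate) ≡ suc k
    τp≡ = ℕ.≤-antisym (ℕ.s≤s⁻¹ (toℕ<n (τ ⟨$⟩ʳ penultimate)))
      -- Here `last` is used as a value, namely `suc k`: the maximum is compared with the value at
      -- its preimage. In `τ⁻¹p≡` below, `penultimate` likewise stands for the value `k`.
      (subst (ℕ._≤ toℕ (τ ⟨$⟩ʳ penultimate)) (trans (cong toℕ (inverseʳ τ)) (toℕ-fromℕ (suc k)))
        (τ≤τp (τ ⟨$⟩ˡ last)))

    τ≤τl : ∀ b → toℕ (τ ⟨$⟩ʳ b) ≢ suc k → τ ⟨$⟩ʳ b ≤ᶠ τ ⟨$⟩ʳ last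
    τ≤τl b τb≢ with view b
    ... | ‵fromℕ                = ℕ.≤-refl
    ... | ‵inj₁ ‵fromℕ          = contradiction τp≡ τb≢
    ... | ‵inj₁ (‵inj₁ {i = c} _) = ℕ.<⇒≤ (e<l c)

    τ⁻¹p≡ : toℕ (τ ⟨$⟩ʳ (τ ⟨$⟩ˡ penultimate)) ≡ k
    τ⁻¹p≡ = trans (cong toℕ (inverseʳ τ)) toℕ-penultimate

    τl≡ : toℕ (τ ⟨$⟩ʳ last) ≡ k
    τl≡ = ℕ.≤-antisym (ℕ.s≤s⁻¹ (subst (toℕ (τ ⟨$⟩ʳ last) ℕ.<_) τp≡ l<p))
      (subst (ℕ._≤ toℕ (τ ⟨$⟩ʳ last)) τ⁻¹p≡
        (τ≤τl (τ ⟨$⟩ˡ penultimate) λ eq → ℕ.1+n≢n (trans (sym eq) τ⁻¹p≡)))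

-- Diagram squares, essential squares and occurrences.

module _ (π : Permutation′ n) where

  diagram? : Decidable (Diagram π)
  diagram? (i , j) = (j <? π ⟨$⟩ʳ i) ×-dec (i <? π ⟨$⟩ˡ j)

  -- Each move raises one coordinate and fixes the other, so one accessibility proof shrinks while
  -- the other is passed on unchanged. When neither move is possible, the two failed searches are
  -- exactly the remaining conditions for an essential square.
  Diagram⇒EssentialSet : ∀ i j → (i , j) ∈ Diagram π →
    Σ[ s ∈ Square n ] s ∈ EssentialSet π × i ≤ᶠ proj₁ s × j ≤ᶠ proj₂ s
  Diagram⇒EssentialSet i₀ j₀ = walk i₀ j₀ (>-wellFounded i₀) (>-wellFounded j₀)
    where
    walk : ∀ i j → Acc _>_ i → Acc _>_ j → (i , j) ∈ Diagram π →
      Σ[ s ∈ Square n ] s ∈ EssentialSet π × i ≤ᶠ proj₁ s × j ≤ᶠ proj₂ s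
    walk i j acc-i@(acc rec-i) acc-j@(acc rec-j) d
      with any? (λ i′ → (label i′ ℕ.≟ suc (label i)) ×-dec diagram? (i′ , j))
         | any? (λ j′ → (label j′ ℕ.≟ suc (label j)) ×-dec diagram? (i , j′))
    ... | yes (i′ , eq , d′) | _ =
      let i<i′ = ℕ.≤-reflexive (sym (ℕ.suc-injective eq))
          s , s∈E , i′≤ , j≤ = walk i′ j (rec-i i<i′) acc-j d′
      in s , s∈E , ℕ.≤-trans (ℕ.<⇒≤ i<i′) i′≤ , j≤
    ... | no _ | yes (j′ , eq , d′) =
      let j<j′ = ℕ.≤-reflexive (sym (ℕ.suc-injective eq))
          s , s∈E , i≤ , j′≤ = walk i j′ acc-i (rec-j j<j′) d′
      in s , s∈E , i≤ , ℕ.≤-trans (ℕ.<⇒≤ j<j′) j′≤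
    ... | no ¬down | no ¬right =
      (i , j) ,
      (d , (λ i′ eq d′ → ¬down (i′ , eq , d′)) , (λ j′ eq d′ → ¬right (j′ , eq , d′))) ,
      ℕ.≤-refl , ℕ.≤-refl

  Contains⇒k≤rank : (τ : Permutation′ (2 ℕ.+ k)) → τ ∈ T (2 ℕ.+ k) → Contains π τ →
    Σ[ s ∈ Square n ] s ∈ EssentialSet π × k ≤ rank π s
  Contains⇒k≤rank {k} τ τ∈T (ι , ι< , π∼τ) =
    let e<l , l<p = T⇒EndsInTopDescent τ τ∈T
        πl<πp = from (π∼τ last penultimate) l<p
        -- The walk starts in the row of the penultimate dot of the occurrence and the column of its
        -- last dot; the final descent puts this square in the diagram.
        s , s∈E , i≤ , j≤ = Diagram⇒EssentialSet (ι penultimate) (π ⟨$⟩ʳ ι last)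
          (πl<πp , subst (ι penultimate <_) (sym (inverseˡ π)) (ι< _ _ penultimate<last))
    -- The `k` earlier dots lie strictly above and to the left of the starting square, hence also of
    -- `s`, so they are counted by its rank.
    in s , s∈E , injective⇒≤length-filter _
         (increasing⇒injective {g = ι ∘ earlier} λ b c b<c → ι< _ _ (earlier-increasing b c b<c))
         (λ b → ℕ.<-≤-trans (ι< _ _ (earlier<penultimate b)) i≤ ,
                ℕ.<-≤-trans (from (π∼τ (earlier b) last) (e<l b)) j≤)
    where open Equivalence

  -- The pattern is read off by standardizing the values of `π` along `ι`, so the occurrence comes
  -- with it. What remains is to transport the order relations of the chosen dots to `τ` and
  -- conclude membership in `T`.
  k≤rank⇒Contains : ∀ s → s ∈ Diagram π → k ≤ rank π s →
    Σ[ τ ∈ Permutation′ (2 ℕ.+ k) ] τ ∈ T (2 ℕ.+ k) × Contains π τ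
  k≤rank⇒Contains {k} (i , j) (πi>j , π⁻¹j>i) k≤rank =
    let g , g< , g∈ = ≤length-filter⇒increasing _ k≤rank
        ι = snoc (snoc g i) (π ⟨$⟩ˡ j)
        ι< = snoc-increasing (snoc-increasing g< (proj₁ ∘ g∈))
          (snoc-All {P = _< (π ⟨$⟩ˡ j)} (λ b → <-trans (proj₁ (g∈ b)) π⁻¹j>i) π⁻¹j>i)
        πι-last = trans (cong (π ⟨$⟩ʳ_) (snoc-fromℕ (snoc g i) _)) (inverseʳ π)
        ι-penultimate = trans (snoc-inject₁ (snoc g i) _ (fromℕ k)) (snoc-fromℕ g i)
        ι-earlier = λ b → trans (snoc-inject₁ (snoc g i) _ (inject₁ b)) (snoc-inject₁ g i b)
        τ , π∼τ = standardize ((π ⟨$⟩ʳ_) ∘ ι) (increasing⇒injective ι< ∘ ⟨$⟩ʳ-injective π)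
        e<l = λ b → to (π∼τ (earlier b) last)
          (subst₂ _<_ (sym (cong (π ⟨$⟩ʳ_) (ι-earlier b))) (sym πι-last) (proj₂ (g∈ b)))
        l<p = to (π∼τ last penultimate)
          (subst₂ _<_ (sym πι-last) (sym (cong (π ⟨$⟩ʳ_) ι-penultimate)) πi>j)
    in τ , EndsInTopDescent⇒T τ (e<l , l<p) , ι , ι< , π∼τ
    where open Equivalence

theorem5p1 : ∀ (m n : ℕ) → m ≥ 3 → (π : Permutation′ n) →
    (∀ (τ : Permutation′ m) → τ ∈ T m → Avoids π τ) ⇔ (∀ (s : Square n) → s ∈ EssentialSet π → rank π s ≤ m ∸ 3)
theorem5p1 (suc (suc (suc m′))) n (s≤s (s≤s (s≤s _))) π = mk⇔
  -- With `m` equal to `3 + m′`, both lemmas apply at `k = suc m′`: then `2 + k` is `m`, and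
  -- `k ≤ rank π s` unfolds to `m′ < rank π s`, which contradicts `rank π s ≤ m ∸ 3`.
  (λ avoids s s∈E → ℕ.≮⇒≥ λ m′<rank →
    let τ , τ∈T , π⊇τ = k≤rank⇒Contains π s (proj₁ s∈E) m′<rank in avoids τ τ∈T π⊇τ)
  (λ rank≤ τ τ∈T π⊇τ →
    let s , s∈E , m′<rank = Contains⇒k≤rank π τ τ∈T π⊇τ in ℕ.<⇒≱ m′<rank (rank≤ s s∈E))
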